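{- For every digraph $D$, $l(D)\ge f^*(D)$.
   Context: A digraph $D$ is finite with nonempty vertex set $V(D)$, and is identified with a relation $D\subseteq V(D)\times V(D)$ (its set of edges; loops are allowed, no multiple edges). $\overline{D}=(V(D)\times V(D))\setminus D$ is its complement. Trees are finite; a leaf is a vertex of degree 1. Subtrees are nonempty connected subgraphs. A subtree representation of $D$ in a host tree $T$ assigns to each vertex $v$ an ordered pair $(S_v,T_v)$ of subtrees of $T$ (the source subtree and the sink subtree of $v$) such that $uv$ is an edge of $D$ if and only if $S_u$ and $T_v$ have a common vertex (for all $u,v\in V(D)$, including $u=v$). The leafage $l(D)$ is the minimum number of leaves of a host tree in which $D$ has a subtree representation. A digraph is a Ferrers digraph if its successor sets $\{u: vu\in E\}$, over all vertices $v$, are linearly ordered by inclusion; equivalently, its adjacency matrix has no $2\times 2$ permutation submatrix (two rows and two columns, not necessarily consecutive). $f^*(D)$ is the minimum number (possibly $0$, if $\overline{D}=\emptyset$) of pairwise disjoint Ferrers digraphs on $V(D)$ (as edge sets) whose union is $\overline{D}$. -}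

module Defs where

open import Data.Nat using (ℕ; _≤_; NonZero; _≟_)
open import Data.Fin using (Fin)
open import Data.Fin.Subset using (Subset; _∈_; _⊆_; _∩_; ∁; ∣_∣; Nonempty)
open import Data.List using (_∷_; _∷ʳ_; length; filter; allFin)
open import Data.List.Relation.Unary.Linked using (Linked)
open import Data.List.Relation.Unary.Unique.Propositional using (Unique)
open import Data.Product using (∃-syntax; Σ-syntax; _×_)
open import Data.Sum using (_⊎_)
open import Function.Bundles using (_⇔_)
open import Level using (0ℓ)
open import Relation.Binary.Core using (Rel)
open import Relation.Binary.Definitions using (Symmetric)
open import Relation.Binary.Construct.Closure.ReflexiveTransitive using (Star)
open import Relation.Binary.PropositionalEquality using (_≡_; _≢_)
open import Relation.Nullary using (¬_)

-- A digraph with vertex set Fin n, given by its successor sets.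
Digraph : ℕ → Set
Digraph n = Fin n → Subset n

Edge : ∀ {n} → Digraph n → Rel (Fin n) 0ℓ
Edge D u v = v ∈ D u

complement : ∀ {n} → Digraph n → Digraph n
complement D v = ∁ (D v)

Ferrers : ∀ {n} → Digraph n → Set
Ferrers F = ∀ u v → F u ⊆ F v ⊎ F v ⊆ F u

record Graph (m : ℕ) : Set where
  field
    neighbours : Fin m → Subset m
  Adj : Rel (Fin m) 0ℓ
  Adj u v = v ∈ neighbours u
  field
    adj-sym    : Symmetric Adj
    adj-irrefl : ∀ v → ¬ Adj v v

  degree : Fin m → ℕ
  degree v = ∣ neighbours v ∣

record Tree (m : ℕ) : Set where
  field
    graph : Graph m
  open Graph graph public
  field
    nonempty  : NonZero m
    connected : ∀ u v → Star Adj u v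
    -- The list x, y, z, zs would be the vertices of a cycle (of length ≥ 3).
    acyclic   : ∀ x y z zs → Unique (x ∷ y ∷ z ∷ zs) →
                ¬ Linked Adj (x ∷ y ∷ z ∷ zs ∷ʳ x)

  leafCount : ℕ
  leafCount = length (filter (λ v → degree v ≟ 1) (allFin m))

record Subtree {m : ℕ} (T : Tree m) : Set where
  open Tree T using (Adj)
  field
    vertices : Subset m
    edges    : Fin m → Subset m
  SubAdj : Rel (Fin m) 0ℓ
  SubAdj a b = b ∈ edges a
  field
    sub-sym   : Symmetric SubAdj
    sub-adj   : ∀ {a b} → SubAdj a b → Adj a b
    endpoint  : ∀ {a b} → SubAdj a b → a ∈ vertices
    nonempty  : Nonempty vertices
    connected : ∀ {a b} → a ∈ vertices → b ∈ vertices → Star SubAdj a b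

record SubtreeRepresentation {n m : ℕ} (D : Digraph n) (T : Tree m) : Set where
  field
    source sink : Fin n → Subtree T
    represents  : ∀ u v →
      Edge D u v ⇔ Nonempty (Subtree.vertices (source u) ∩ Subtree.vertices (sink v))

record FerrersPartition {n : ℕ} (D : Digraph n) (k : ℕ) : Set where
  field
    part     : Fin k → Digraph n
    ferrers  : ∀ i → Ferrers (part i)
    disjoint : ∀ i j → i ≢ j → ∀ u v → Edge (part i) u v → ¬ Edge (part j) u v
    union    : ∀ u v → Edge D u v ⇔ (∃[ i ] Edge (part i) u v)

IsMinimum : (ℕ → Set) → ℕ → Set
IsMinimum P k = P k × (∀ j → P j → k ≤ j)

RepresentableWithLeaves : ∀ {n} → Digraph n → ℕ → Set
RepresentableWithLeaves D k =
  ∃[ m ] Σ[ T ∈ Tree m ] (Tree.leafCount T ≡ k × SubtreeRepresentation D T)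

-- Minima are expressed as relations: `Leafage D l` reads l(D) = l, and
-- `FStar D f` reads f*(D) = f.
Leafage : ∀ {n} → Digraph n → ℕ → Set
Leafage D = IsMinimum (RepresentableWithLeaves D)

FStar : ∀ {n} → Digraph n → ℕ → Set
FStar D = IsMinimum (FerrersPartition (complement D))

{-# OPTIONS --safe #-}
-- Every edge x→y of the host tree bounds a branch: the component of y after
-- deleting x.  A nonedge uv of D determines the branch A entered on leaving the
-- source subtree of u towards the sink subtree of v; it is disjoint from the
-- former and contains the latter.  Every branch contains some leaf and misses
-- another one, so if the leaves are arranged in a cycle, then A contains some leaf
-- but not its successor.  Colour uv by the first such position for A.  Two branches
-- that share a vertex and jointly miss a vertex are nested, so each colour class
-- is a Ferrers digraph, and there are as many colours as leaves.
module Submission where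

open import Data.Fin using (Fin; zero; suc; fromℕ; inject₁; _≟_)
open import Data.Fin.Induction using (<-weakInduction; <-weakInduction-startingFrom)
open import Data.Fin.Properties using (any?; sequence; ≤fromℕ)
open import Data.Fin.Subset using (Subset; _∈_; _∉_; _⊆_; _⊂_; ∣_∣; ⁅_⁆)
open import Data.Fin.Subset.Induction using (⊂-wellFounded)
open import Data.Fin.Subset.Properties
  using (_∈?_; ⊆-antisym; x∈⁅x⁆; x∈⁅y⁆⇒x≡y; ∣⁅x⁆∣≡1; x∈∁p⇒x∉p; x∉p⇒x∈∁p; x∈p∩q⁺; x∈p∩q⁻)
open import Data.List using (List; []; _∷_; _∷ʳ_; allFin; filter; lookup)
open import Data.List.Membership.Propositional using () renaming (_∈_ to _∈ˡ_)
open import Data.List.Membership.Propositional.Properties using (∈-filter⁺; ∈-allFin)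
open import Data.List.Relation.Unary.All using ([]; _∷_)
open import Data.List.Relation.Unary.All.Properties using (¬Any⇒All¬)
open import Data.List.Relation.Unary.AllPairs using ([]; _∷_)
open import Data.List.Relation.Unary.Any as Any using (here; there; index)
open import Data.List.Relation.Unary.Any.Properties using (lookup-index)
open import Data.List.Relation.Unary.Linked as Linked using (Linked; [-]; _∷_)
open import Data.List.Relation.Unary.Unique.Propositional using (Unique)
open import Data.Nat as ℕ using (ℕ; NonZero; _≥_; _≤?_)
open import Data.Product using (∃; ∃-syntax; ∃₂; _×_; _,_; proj₁)
open import Data.Sum using (_⊎_; inj₁; inj₂)
open import Data.Vec using (tabulate)
open import Data.Vec.Properties using (lookup∘tabulate; []=⇒lookup; lookup⇒[]=)
open import Effect.Monad using (RawMonad)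
open import Function using (_∘_; _⇔_; mk⇔; Equivalence)
open import Induction.WellFounded using (Acc; acc)
open import Level using (0ℓ)
open import Relation.Binary.Construct.Closure.ReflexiveTransitive
  using (Star; ε; _◅_; _◅◅_; map; reverse)
open import Relation.Binary.Core using (Rel)
open import Relation.Binary.PropositionalEquality
  using (_≡_; _≢_; refl; sym; trans; cong; subst)
open import Relation.Nullary
  using (¬_; Dec; yes; no; does; contradiction; ¬?; _×-dec_; decidable-stable; ¬¬-excluded-middle)
open import Relation.Nullary.Negation using (¬¬-Monad; ¬¬-map)
open import Relation.Nullary.Decidable using (dec-true)
open import Relation.Unary using (Decidable)
open import Defs

open Equivalence using (to; from)

-- Subsets from predicates, up to double negation.

¬¬-∀ : ∀ {n} {P : Fin n → Set} → (∀ i → ¬ ¬ P i) → ¬ ¬ (∀ i → P i)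
¬¬-∀ = sequence (RawMonad.rawApplicative ¬¬-Monad)

∈-tabulate : ∀ {n} {P : Fin n → Set} (P? : Decidable P) k →
             k ∈ tabulate (does ∘ P?) ⇔ P k
∈-tabulate {P = P} P? k = mk⇔ ⇒ ⇐
  where
  ⇒ : k ∈ tabulate (does ∘ P?) → P k
  ⇒ k∈ with P? k | trans (sym (lookup∘tabulate (does ∘ P?) k)) ([]=⇒lookup k∈)
  ... | yes p | _ = p

  ⇐ : P k → k ∈ tabulate (does ∘ P?)
  ⇐ p = lookup⇒[]= k _ (trans (lookup∘tabulate (does ∘ P?) k) (dec-true (P? k) p))

-- Finitely many instances of excluded middle hold together under double negation. Inside a negated
-- goal, a predicate thus becomes a family of subsets with decidable membership.
¬¬-comprehension : ∀ {a b c} (P : Fin a → Fin b → Fin c → Set) →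
  ¬ ¬ (∃ λ (R : Fin a → Fin b → Subset c) → ∀ i j k → k ∈ R i j ⇔ P i j k)
¬¬-comprehension P =
  ¬¬-map (λ P? → (λ i j → tabulate (does ∘ P? i j)) , λ i j → ∈-tabulate (P? i j))
         (¬¬-∀ λ i → ¬¬-∀ λ j → ¬¬-∀ λ k → ¬¬-excluded-middle {A = P i j k})

-- Cyclic order of positions.

pred-cyclic : ∀ {n} → Fin n → Fin n
pred-cyclic {ℕ.suc n} zero = fromℕ n
pred-cyclic (suc i)        = inject₁ i

-- Without a descent, `Q` passes from each position to the next: from `i` up to the last one, round
-- to `zero`, and then everywhere, including `j`.
cyclic-descent : ∀ {n} {Q : Fin n → Set} → Decidable Q → ∃ Q → ∃ (¬_ ∘ Q) →
                 ∃ λ c → Q (pred-cyclic c) × ¬ Q c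
cyclic-descent {ℕ.suc n} {Q} Q? (i , Qi) (j , ¬Qj)
  with any? (λ c → Q? (pred-cyclic c) ×-dec ¬? (Q? c))
... | yes d = d
... | no ¬d = contradiction (<-weakInduction Q Q₀ (step ∘ suc) j) ¬Qj
  where
  step : ∀ c → Q (pred-cyclic c) → Q c
  step c Qp = decidable-stable (Q? c) (λ ¬Qc → ¬d (c , Qp , ¬Qc))

  Q₀ : Q zero
  Q₀ = step zero (<-weakInduction-startingFrom Q Qi (step ∘ suc) (≤fromℕ i))

-- Walks confined to a predicate.

module _ {A : Set} where

  -- The condition sits on the steps, so `ε` says nothing about its vertex; this is why
  -- `restrict-head` and `restrict-last` assume it at the opposite end.
  Restrict : (A → Set) → Rel A 0ℓ → Rel A 0ℓ
  Restrict P R a b = R a b × P a × P b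

  restrict-head : ∀ {P R a b} → Star (Restrict P R) a b → P b → P a
  restrict-head ε                  p = p
  restrict-head ((_ , p , _) ◅ _)  _ = p

  restrict-last : ∀ {P R a b} → Star (Restrict P R) a b → P a → P b
  restrict-last ε                  p = p
  restrict-last ((_ , _ , p) ◅ w)  _ = restrict-last w p

  last-exit : ∀ {P : A → Set} {R a b} → Decidable P → Star R a b → ¬ P b →
    Star (Restrict (¬_ ∘ P) R) a b ⊎
    ∃₂ λ p q → P p × ¬ P q × R p q × Star (Restrict (¬_ ∘ P) R) q b
  last-exit P? ε ¬Pb = inj₁ ε
  last-exit {a = a} P? (_◅_ {j = c} r w) ¬Pb with last-exit P? w ¬Pb
  ... | inj₂ e = inj₂ e
  ... | inj₁ w′ with P? a
  ...   | yes Pa = inj₂ (a , c , Pa , restrict-head w′ ¬Pb , r , w′)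
  ...   | no ¬Pa = inj₁ ((r , ¬Pa , restrict-head w′ ¬Pb) ◅ w′)

-- Simple paths closing up at a vertex.

module _ {m : ℕ} (G : Graph m) where
  open Graph G

  Avoiding : Fin m → Rel (Fin m) 0ℓ
  Avoiding x = Restrict (_≢ x) Adj

  avoiding-reverse : ∀ {x a b} → Star (Avoiding x) a b → Star (Avoiding x) b a
  avoiding-reverse = reverse λ (e , p , q) → adj-sym e , q , p

  module _ (x y′ : Fin m) where

    -- The side condition excludes the degenerate cycle y, x; unlike a condition on
    -- the end of a path, it is inherited by suffixes.
    ReturnStep : Rel (Fin m) 0ℓ
    ReturnStep a b = Adj a b × (b ≡ x → a ≡ y′)

    Returning : List (Fin m) → Set
    Returning l = Unique (x ∷ l) × Linked ReturnStep (l ∷ʳ x)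

    returning-suffix : ∀ {a l} → a ∈ˡ l → Returning l → ∃ λ zs → Returning (a ∷ zs)
    returning-suffix {l = _ ∷ zs}    (here refl) r = zs , r
    returning-suffix {l = _ ∷ _ ∷ _} (there a∈)  ((_ ∷ x∉) ∷ _ ∷ u , _ ∷ s) =
      returning-suffix a∈ (x∉ ∷ u , s)

    -- Loop erasure: prepend `a`, unless the path already visits it; then cut the path back to that
    -- visit.
    returning-path : ∀ {a} → Star (Avoiding x) a y′ → a ≢ x → Adj y′ x →
                     ∃ λ zs → Returning (a ∷ zs)
    returning-path ε a≢x e =
      [] , (((a≢x ∘ sym) ∷ []) ∷ [] ∷ []) , ((e , λ _ → refl) ∷ [-])
    returning-path {a} (_◅_ {j = b} (ab , _ , b≢x) w) a≢x e
      with returning-path w b≢x e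
    ... | zs , r@((x∉ ∷ u) , s) with Any.any? (a ≟_) (b ∷ zs)
    ...   | yes a∈ = returning-suffix a∈ r
    ...   | no  a∉ = b ∷ zs , (((a≢x ∘ sym) ∷ x∉) ∷ ¬Any⇒All¬ _ a∉ ∷ u) ,
                     ((ab , λ b≡x → contradiction b≡x b≢x) ∷ s)

-- Separation by an edge of the tree.

module _ {m : ℕ} (T : Tree m) where
  open Tree T

  Reach : Fin m → Fin m → Fin m → Set
  Reach x y z = Star (Avoiding graph x) y z

  adj⇒≢ : ∀ {a b} → Adj a b → a ≢ b
  adj⇒≢ e refl = adj-irrefl _ e

  reach⇒≢ : ∀ {x y z} → Adj x y → Reach x y z → z ≢ x
  reach⇒≢ e w = restrict-last w (adj⇒≢ (adj-sym e))

  -- Loop erasure turns `w` into a simple path from `y` closing up at `x`. With two or more vertices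
  -- it yields a cycle; with one, the side condition of `ReturnStep` is the equation.
  neighbour-unique : ∀ {x y y′} → Adj x y → Adj x y′ → Reach x y y′ → y ≡ y′
  neighbour-unique {x} {y} {y′} xy xy′ w
    with returning-path graph x y′ w (adj⇒≢ (adj-sym xy)) (adj-sym xy′)
  ... | []     , _ , ((_ , y≡y′) ∷ _) = y≡y′ refl
  ... | z ∷ zs , u , s =
    contradiction (xy ∷ Linked.map proj₁ s) (acyclic x y z zs u)

  -- The reversal of `back` leaves `x` for the last time towards a neighbour `q` other than `y`. Its
  -- remainder, joined to `w`, connects `y` to `q` away from `x`, against `neighbour-unique`.
  no-return : ∀ {x y z} → Adj x y → Reach x y z → ¬ Star (Avoiding graph y) z x
  no-return {x} {y} xy w back
    with last-exit (_≟ x) (avoiding-reverse graph back) (reach⇒≢ xy w)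
  ... | inj₁ v = restrict-head v (reach⇒≢ xy w) refl
  ... | inj₂ (_ , q , refl , _ , (xq , _ , q≢y) , v) =
    q≢y (sym (neighbour-unique xy xq
      (w ◅◅ avoiding-reverse graph (map (λ ((e , _) , p , q) → e , p , q) v))))

  branches-disjoint : ∀ {x y z} → Adj x y → Reach x y z → ¬ Reach y x z
  branches-disjoint xy w v = no-return xy w (avoiding-reverse graph v)

  -- Otherwise a walk inside `S` from `z` to `x` would be a return avoiding `y`.
  subtree-avoids-branch : ∀ {x y z} (S : Subtree T) → Adj x y → x ∈ Subtree.vertices S →
    y ∉ Subtree.vertices S → Reach x y z → z ∉ Subtree.vertices S
  subtree-avoids-branch {y = y} S xy x∈ y∉ w z∈ = no-return xy w
    (map (λ e → sub-adj e , inside e , inside (sub-sym e)) (Subtree.connected S z∈ x∈))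
    where
    open Subtree S using (SubAdj; sub-adj; sub-sym; endpoint)
    inside : ∀ {a b} → SubAdj a b → a ≢ y
    inside e refl = y∉ (endpoint e)

  -- Its length is `leafCount` by definition, so positions in this list serve directly as colours.
  leaves : List (Fin m)
  leaves = filter (λ v → degree v ℕ.≟ 1) (allFin m)

  leaf-index : ∀ {v} → degree v ≡ 1 → ∃ λ i → lookup leaves i ≡ v
  leaf-index {v} deg = index v∈ , sym (lookup-index v∈)
    where
    v∈ : v ∈ˡ leaves
    v∈ = ∈-filter⁺ (λ v → degree v ℕ.≟ 1) (∈-allFin v) deg

  unique-neighbour⇒leaf : ∀ {x y} → Adj y x → (∀ z → Adj y z → z ≡ x) → degree y ≡ 1
  unique-neighbour⇒leaf {x} {y} yx only = trans (cong ∣_∣ eq) (∣⁅x⁆∣≡1 x)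
    where
    eq : neighbours y ≡ ⁅ x ⁆
    eq = ⊆-antisym (λ z∈ → subst (_∈ ⁅ x ⁆) (sym (only _ z∈)) (x∈⁅x⁆ x))
                   (λ z∈ → subst (_∈ neighbours y) (sym (x∈⁅y⁆⇒x≡y x z∈)) yx)

  -- Branches as subsets, and their nesting.

  module Branches
    (H   : Fin m → Fin m → Subset m)
    (H⇔  : ∀ x y z → z ∈ H x y ⇔ Reach x y z)
    where

    root∈ : ∀ {x y} → y ∈ H x y
    root∈ = from (H⇔ _ _ _) ε

    extend : ∀ {x y a b} → a ∈ H x y → Star (Avoiding graph x) a b → b ∈ H x y
    extend a∈ w = from (H⇔ _ _ _) (to (H⇔ _ _ _) a∈ ◅◅ w)

    walk-inside : ∀ {x y a b} → a ∈ H x y → Star (Avoiding graph x) a b →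
                  Star (Restrict (_∈ H x y) Adj) a b
    walk-inside a∈ ε       = ε
    walk-inside a∈ (s ◅ w) = (proj₁ s , a∈ , c∈) ◅ walk-inside c∈ w
      where c∈ = extend a∈ (s ◅ ε)

    -- A walk can leave the branch only through `x`, so the part after the last exit starts at `x`.
    walk-outside : ∀ {x y z} → Adj x y → z ∉ H x y →
                   Star (Restrict (_∉ H x y) Adj) x z
    walk-outside {x} {y} {z} xy z∉ with last-exit (_∈? H x y) (connected x z) z∉
    ... | inj₁ w = w
    ... | inj₂ (p , q , p∈ , q∉ , pq , w) with q ≟ x
    ...   | yes refl = w
    ...   | no  q≢x  = contradiction
      (extend p∈ ((pq , reach⇒≢ xy (to (H⇔ _ _ _) p∈) , q≢x) ◅ ε)) q∉

    avoid : ∀ {P : Fin m → Set} {x a b} → (∀ {c} → P c → c ≢ x) →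
            Star (Restrict P Adj) a b → Star (Avoiding graph x) a b
    avoid f = map λ (e , p , q) → e , f p , f q

    separate : ∀ {A : Subset m} {x c} → x ∉ A → c ∈ A → c ≢ x
    separate x∉ c∈ refl = x∉ c∈

    -- Every vertex of `H x y` is reached from `b` within `H x y`, hence without meeting `x′`.
    meets⇒⊆ : ∀ {x y x′ y′ b} → b ∈ H x y → b ∈ H x′ y′ → x′ ∉ H x y → H x y ⊆ H x′ y′
    meets⇒⊆ b∈ b∈′ x′∉ z∈ = extend b∈′ (avoid (separate x′∉) (walk-inside b∈
      (avoiding-reverse graph (to (H⇔ _ _ _) b∈) ◅◅ to (H⇔ _ _ _) z∈)))

    nested : ∀ {x y x′ y′ b c} → Adj x y → b ∈ H x y → b ∈ H x′ y′ →
             c ∉ H x y → c ∉ H x′ y′ → H x y ⊆ H x′ y′ ⊎ H x′ y′ ⊆ H x y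
    nested {x} {y} {x′} {y′} xy b∈ b∈′ c∉ c∉′ with x′ ∈? H x y | x ∈? H x′ y′
    ... | no x′∉  | _      = inj₁ (meets⇒⊆ b∈ b∈′ x′∉)
    ... | yes _   | no x∉′ = inj₂ (meets⇒⊆ b∈′ b∈ x∉′)
    -- The walk from `x` to `c` outside `H x y` misses `x′`, so it would carry `c` into `H x′ y′`.
    ... | yes x′∈ | yes x∈′ = contradiction
      (extend x∈′ (avoid (λ { z∉ refl → z∉ x′∈ }) (walk-outside xy c∉))) c∉′

    subbranch : ∀ {x y z} → Adj x y → Adj y z → z ≢ x → H y z ⊂ H x y
    subbranch {x} {y} {z} xy yz z≢x =
      meets⇒⊆ root∈ z∈ x∉ , y , root∈ , λ y∈ → reach⇒≢ yz (to (H⇔ _ _ _) y∈) refl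
      where
      z∈ : z ∈ H x y
      z∈ = extend root∈ ((yz , adj⇒≢ (adj-sym xy) , z≢x) ◅ ε)
      x∉ : x ∉ H y z
      x∉ x∈ = z≢x (neighbour-unique yz (adj-sym xy) (to (H⇔ _ _ _) x∈))

    -- Moving on to a further neighbour shrinks the branch strictly; when none is left, the root
    -- itself is a leaf.
    leaf-in-branch : ∀ {x y} → Adj x y → ∃ λ v → v ∈ H x y × degree v ≡ 1
    leaf-in-branch = go (⊂-wellFounded _)
      where
      go : ∀ {x y} → Acc _⊂_ (H x y) → Adj x y → ∃ λ v → v ∈ H x y × degree v ≡ 1
      go {x} {y} (acc rec) xy
        with any? (λ z → z ∈? neighbours y ×-dec ¬? (z ≟ x))
      ... | yes (z , yz , z≢x) with go (rec (subbranch xy yz z≢x)) yz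
      ...   | v , v∈ , deg = v , proj₁ (subbranch xy yz z≢x) v∈ , deg
      go {x} {y} (acc rec) xy | no none = y , root∈ ,
        unique-neighbour⇒leaf (adj-sym xy)
          (λ z yz → decidable-stable (z ≟ x) (λ z≢x → none (z , yz , z≢x)))

    -- Colours of branches.

    Descent : Subset m → Fin leafCount → Set
    Descent A c = lookup leaves (pred-cyclic c) ∈ A × lookup leaves c ∉ A

    descent? : ∀ A → Dec (∃ (Descent A))
    descent? A = any? λ c →
      (lookup leaves (pred-cyclic c) ∈? A) ×-dec ¬? (lookup leaves c ∈? A)

    -- The equation selects one descent for each subset.
    HasColour : Subset m → Fin leafCount → Set
    HasColour A c = ∃ λ (d : Descent A c) → descent? A ≡ yes (c , d)

    colour-unique : ∀ {A c c′} → HasColour A c → HasColour A c′ → c ≡ c′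
    colour-unique (_ , eq) (_ , eq′) with refl ← trans (sym eq) eq′ = refl

    -- The opposite branch `H y x` also contains a leaf and is disjoint from `H x y`, so
    -- `cyclic-descent` applies.
    branch-colour : ∀ {x y} → Adj x y → ∃ (HasColour (H x y))
    branch-colour {x} {y} xy with descent? (H x y)
    ... | yes (c , d) = c , d , refl
    ... | no ¬d
      with leaf-in-branch xy | leaf-in-branch (adj-sym xy)
    ...   | v , v∈ , deg | v′ , v′∈ , deg′
      with leaf-index deg | leaf-index deg′
    ...     | i , refl | j , refl = contradiction
      (cyclic-descent (λ i → lookup leaves i ∈? H x y) (i , v∈)
        (j , λ j∈ → branches-disjoint xy (to (H⇔ _ _ _) j∈) (to (H⇔ _ _ _) v′∈)))
      ¬d

    -- Colour classes of nonedges.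

    module _ {n : ℕ} {D : Digraph n} (rep : SubtreeRepresentation D T) where
      open SubtreeRepresentation rep

      src snk : Fin n → Subset m
      src u = Subtree.vertices (source u)
      snk v = Subtree.vertices (sink v)

      -- The vertex `v` enters only through `sink⊆`, which is what makes the exchange of sinks in
      -- `resink` possible.
      record Separates (x y : Fin m) (u v : Fin n) : Set where
        constructor separates
        field
          adjacent : Adj x y
          tail∈    : x ∈ src u
          head∉    : y ∉ src u
          sink⊆    : snk v ⊆ H x y

      open Separates

      resink : ∀ {x y u v w} → Separates x y u v → snk w ⊆ H x y → Separates x y u w
      resink s ⊆H = separates (adjacent s) (tail∈ s) (head∉ s) ⊆H

      branch∩source : ∀ {x y u v z} → Separates x y u v → z ∈ H x y → z ∉ src u
      branch∩source {u = u} s z∈ =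
        subtree-avoids-branch (source u) (adjacent s) (tail∈ s) (head∉ s) (to (H⇔ _ _ _) z∈)

      separates⇒nonedge : ∀ {x y u v} → Separates x y u v → ¬ Edge D u v
      separates⇒nonedge {u = u} {v} s uv with to (represents u v) uv
      ... | z , z∈ with x∈p∩q⁻ (src u) (snk v) z∈
      ...   | z∈S , z∈T = branch∩source s (sink⊆ s z∈T) z∈S

      nonedge⇒separates : ∀ {u v} → ¬ Edge D u v → ∃₂ λ x y → Separates x y u v
      nonedge⇒separates {u} {v} ¬uv
        with Subtree.nonempty (source u) | Subtree.nonempty (sink v)
      ... | s , s∈ | t , t∈ = result
        where
        disjoint : ∀ {z} → z ∈ snk v → z ∉ src u
        disjoint z∈T z∈S = ¬uv (from (represents u v) (_ , x∈p∩q⁺ (z∈S , z∈T)))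

        open Subtree (sink v) using (sub-adj; sub-sym; endpoint)

        result : ∃₂ λ x y → Separates x y u v
        result with last-exit (_∈? src u) (connected s t) (disjoint t∈)
        ... | inj₁ w = contradiction s∈ (restrict-head w (disjoint t∈))
        ... | inj₂ (x , y , x∈ , y∉ , xy , w) = x , y , separates xy x∈ y∉ λ z∈ →
          -- The walk after the last exit, continued inside the sink subtree, misses `src u` and
          -- hence `x`.
          from (H⇔ _ _ _) (avoid (λ { c∉ refl → c∉ x∈ })
            (w ◅◅ map (λ e → sub-adj e , disjoint (endpoint e) , disjoint (endpoint (sub-sym e)))
                      (Subtree.connected (sink v) t∈ z∈)))

      -- Both branches contain the sink subtree, and the first misses `src u`, where `x′` lies. By
      -- symmetry the branch, and with it the colour, depends only on `u` and `v`.
      separates⊆ : ∀ {x y x′ y′ u v} → Separates x y u v → Separates x′ y′ u v →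
                   H x y ⊆ H x′ y′
      separates⊆ {v = v} s s′ with Subtree.nonempty (sink v)
      ... | t , t∈ = meets⇒⊆ (sink⊆ s t∈) (sink⊆ s′ t∈)
                       (λ x′∈ → branch∩source s x′∈ (tail∈ s′))

      Class : Fin leafCount → Fin n → Fin n → Set
      Class c u v = ∃₂ λ x y → Separates x y u v × HasColour (H x y) c

      class-unique : ∀ {c c′ u v} → Class c u v → Class c′ u v → c ≡ c′
      class-unique {c′ = c′} (x , y , s , h) (x′ , y′ , s′ , h′) =
        colour-unique h (subst (λ A → HasColour A c′)
                               (⊆-antisym (separates⊆ s′ s) (separates⊆ s s′)) h′)

      -- The leaf before position `c` lies in both branches and the leaf at `c` in neither, so they
      -- are nested; the larger one contains both sinks. This excludes a 2 by 2 permutation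
      -- submatrix.
      class-exchange : ∀ {c u v u′ v′} → Class c u v → Class c u′ v′ →
                       Class c u′ v ⊎ Class c u v′
      class-exchange (x , y , s , h@((b∈ , c∉) , _)) (x′ , y′ , s′ , h′@((b∈′ , c∉′) , _))
        with nested (adjacent s) b∈ b∈′ c∉ c∉′
      ... | inj₁ A⊆A′ = inj₁ (x′ , y′ , resink s′ (A⊆A′ ∘ sink⊆ s) , h′)
      ... | inj₂ A′⊆A = inj₂ (x , y , resink s (A′⊆A ∘ sink⊆ s′) , h)

      classes-partition : (R : Fin leafCount → Digraph n) →
        (∀ c u v → v ∈ R c u ⇔ Class c u v) → FerrersPartition (complement D) leafCount
      classes-partition R R⇔ = record
        { part     = R
        ; ferrers  = ferrers
        ; disjoint = λ i j i≢j u v p q →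
            i≢j (class-unique (to (R⇔ i u v) p) (to (R⇔ j u v) q))
        ; union    = λ u v → mk⇔ ⇒ ⇐
        }
        where
        ferrers : ∀ c → Ferrers (R c)
        ferrers c u u′
          with any? (λ v → v ∈? R c u ×-dec ¬? (v ∈? R c u′))
        ... | no none = inj₁ λ {v} v∈ →
          decidable-stable (v ∈? R c u′) (λ v∉ → none (v , v∈ , v∉))
        ... | yes (v , v∈ , v∉) = inj₂ exchange
          where
          exchange : R c u′ ⊆ R c u
          exchange {v′} v′∈
            with class-exchange (to (R⇔ c u v) v∈) (to (R⇔ c u′ v′) v′∈)
          ... | inj₁ u′v = contradiction (from (R⇔ c u′ v) u′v) v∉
          ... | inj₂ uv′ = from (R⇔ c u v′) uv′

        ⇒ : ∀ {u v} → Edge (complement D) u v → ∃[ c ] Edge (R c) u v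
        ⇒ uv∈ with nonedge⇒separates (x∈∁p⇒x∉p uv∈)
        ... | x , y , s with branch-colour (adjacent s)
        ...   | c , h = c , from (R⇔ c _ _) (x , y , s , h)

        ⇐ : ∀ {u v} → ∃[ c ] Edge (R c) u v → Edge (complement D) u v
        ⇐ (c , uv∈) with to (R⇔ c _ _) uv∈
        ... | x , y , s , _ = x∉p⇒x∈∁p (separates⇒nonedge s)

  -- `Class` is stated in terms of the subsets `H`, so comprehension is applied first to `Reach` and
  -- then to the classes.
  ¬¬-partition : ∀ {n} {D : Digraph n} → SubtreeRepresentation D T →
                 ¬ ¬ FerrersPartition (complement D) leafCount
  ¬¬-partition rep ¬part =
    ¬¬-comprehension Reach λ (H , H⇔) →
    ¬¬-comprehension (Branches.Class H H⇔ rep) λ (R , R⇔) →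
    ¬part (Branches.classes-partition H H⇔ rep R R⇔)

-- The classes are only shown to be decidable up to double negation, which is
-- enough because the inequality is decidable.
theorem3 : ∀ (n : ℕ) → .{{_ : NonZero n}} → (D : Digraph n) (l f : ℕ) →
    Leafage D l → FStar D f → l ≥ f
theorem3 n D l f ((m , T , refl , rep) , _) (_ , minimal) =
  decidable-stable (f ≤? l) λ f≰l → ¬¬-partition T rep λ part → f≰l (minimal l part)
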